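{- Let $\mathcal{G}=(V,E,\lambda)$ be a happy compressed temporal graph. If $\mathcal{G}$ is two-path-free, then $\mathcal{G}$ is acyclic.
   Context: A happy temporal graph is a triple $\mathcal{G}=(V,E,\lambda)$ where $(V,E)$ is a finite simple undirected graph (the footprint) and $\lambda:E\to\{1,2,3,\dots\}$ assigns a single time label to each edge, such that two distinct edges sharing an endpoint have different labels. It is compressed if for every edge $e$ with $\lambda(e)>1$ there is an edge $e'$ adjacent to $e$ with $\lambda(e')=\lambda(e)-1$. A temporal walk is a walk in the footprint along which edge labels are strictly increasing (so no edge is repeated). $\mathcal{G}$ is two-path-free if for all distinct $u,v\in V$ there is at most one temporal walk from $u$ to $v$. A temporal cycle is a nonempty temporal walk from a vertex to itself; $\mathcal{G}$ is acyclic if it has no temporal cycle. -}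

module Defs where

open import Data.Bool using (Bool; T)
open import Data.Fin using (Fin)
open import Data.Fin.Subset using (Subset; _∈_; ∣_∣; ⁅_⁆; _∪_)
open import Data.List using (List; []; _∷_; map; length)
open import Data.List.Relation.Unary.Linked using (Linked)
open import Data.Nat using (ℕ; _<_; _≤_; _∸_)
open import Data.Product using (Σ; ∃; _×_; proj₁)
open import Relation.Binary.PropositionalEquality using (_≡_; _≢_)
open import Relation.Nullary using (¬_)

-- The edge set is a set of two-element subsets of the vertex set Fin ∣V∣.
-- It is given by its Boolean characteristic function, so that membership is
-- proof-irrelevant and _≡_ on Edge is equality of the underlying subsets.
record SimpleGraph : Set where
  field
    ∣V∣       : ℕ
    isEdge    : Subset ∣V∣ → Bool
    edge-size : ∀ e → T (isEdge e) → ∣ e ∣ ≡ 2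

  V : Set
  V = Fin ∣V∣

  Edge : Set
  Edge = Σ (Subset ∣V∣) λ e → T (isEdge e)

  _endpointOf_ : V → Edge → Set
  x endpointOf e = x ∈ proj₁ e

  Adjacent : Edge → Edge → Set
  Adjacent e e′ = e ≢ e′ × ∃ λ x → x endpointOf e × x endpointOf e′

  -- e = {u , v}; by edge-size this forces u ≢ v.
  Joins : Edge → V → V → Set
  Joins e u v = proj₁ e ≡ ⁅ u ⁆ ∪ ⁅ v ⁆

  -- Joins is proof-irrelevant (Subset ∣V∣ has decidable equality), so two walks
  -- are _≡_ exactly when they traverse the same vertices and edges in order.
  data Walk : V → V → Set where
    []   : ∀ {u} → Walk u u
    step : ∀ {u v w} (e : Edge) → Joins e u v → Walk v w → Walk u w

  edges : ∀ {u v} → Walk u v → List Edge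
  edges []           = []
  edges (step e _ p) = e ∷ edges p

record HappyTemporalGraph : Set where
  field
    footprint : SimpleGraph

  open SimpleGraph footprint public

  field
    label          : Edge → ℕ
    label-positive : ∀ e → 1 ≤ label e
    happy          : ∀ e e′ → Adjacent e e′ → label e ≢ label e′

  Temporal : ∀ {u v} → Walk u v → Set
  Temporal p = Linked _<_ (map label (edges p))

  TemporalCycle : V → Set
  TemporalCycle v = Σ (Walk v v) λ p → Temporal p × 0 < length (edges p)

  Compressed : Set
  Compressed = ∀ e → 1 < label e →
    ∃ λ e′ → Adjacent e e′ × label e′ ≡ label e ∸ 1

  TwoPathFree : Set
  TwoPathFree = ∀ u v → u ≢ v → (p q : Walk u v) →
    Temporal p → Temporal q → p ≡ q

  Acyclic : Set
  Acyclic = ∀ v → ¬ TemporalCycle v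

{-# OPTIONS --safe #-}
-- If a temporal cycle at u starts with an edge e = {u , v}, then e traversed
-- backwards and the rest of the cycle are both temporal walks from v to u.
-- They coincide by two-path-freeness, so the cycle is e followed by e, whose
-- labels do not increase.
module Submission where

open import Defs
open import Data.Fin.Subset using (∣_∣; ⁅_⁆)
open import Data.Fin.Subset.Properties using (∪-comm; ∪-idem; ∣⁅x⁆∣≡1)
open import Data.List.Relation.Unary.Linked using ([-]; _∷_; tail)
open import Data.Nat.Properties using (<-irrefl)
open import Data.Product using (_,_)
open import Relation.Binary.PropositionalEquality
  using (_≡_; _≢_; refl; sym; trans; cong)
open import Relation.Nullary using (¬_)

module _ (S : SimpleGraph) where
  open SimpleGraph S

  Joins-sym : ∀ {e u v} → Joins e u v → Joins e v u
  Joins-sym {u = u} {v} e≡uv = trans e≡uv (∪-comm ⁅ u ⁆ ⁅ v ⁆)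

  -- An edge has size 2 by `edge-size`, whereas `⁅ u ⁆ ∪ ⁅ u ⁆` collapses to a singleton.
  Joins-irrefl : ∀ {e u} → ¬ Joins e u u
  Joins-irrefl {e , isEdge-e} {u} e≡uu
    with () ← trans (sym (edge-size e isEdge-e))
                (trans (cong ∣_∣ (trans e≡uu (∪-idem ⁅ u ⁆))) (∣⁅x⁆∣≡1 u))

  -- Supplies the distinct endpoints that `TwoPathFree` asks for.
  Joins⇒≢ : ∀ {e u v} → Joins e u v → u ≢ v
  Joins⇒≢ {e} e≡uv refl = Joins-irrefl {e} e≡uv

lemma3p9 : (G : HappyTemporalGraph) →
    HappyTemporalGraph.Compressed G →
    HappyTemporalGraph.TwoPathFree G →
    HappyTemporalGraph.Acyclic G
-- The empty walk has no clause: its length would have to satisfy `0 < 0`.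
lemma3p9 G _ twoPathFree u (SimpleGraph.step {v = v} e e≡uv p , p↗ , _) =
  e∷p-not-temporal back≡p p↗
  where
  open HappyTemporalGraph G

  e≡vu : Joins e v u
  e≡vu = Joins-sym footprint {e} e≡uv

  back≡p : step e e≡vu [] ≡ p
  back≡p = twoPathFree v u (Joins⇒≢ footprint {e} e≡vu) _ p [-] (tail p↗)

  -- With `q` a variable, matching on `refl` turns the cycle into `e` followed by `e`, whose first
  -- link is `label e < label e`.
  e∷p-not-temporal : ∀ {q : Walk v u} → step e e≡vu [] ≡ q →
    ¬ Temporal (step e e≡uv q)
  e∷p-not-temporal refl (e<e ∷ _) = <-irrefl refl e<e
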